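{- For every $n\in\mathbb N$, the set $\{\mathrm{First}(n),\ \mathrm{Next}(\mathrm{First}(n)),\ \mathrm{Next}(\mathrm{Next}(\mathrm{First}(n))),\ldots\}$ of naturally labeled topologies obtained by iteratively applying $\mathrm{Next}$ to $\mathrm{First}(n)$ (until $\mathrm{Next}$ is undefined) is exactly the set of all naturally labeled topologies of size $n$.
   Context: Let $X_n=\{0,1,\ldots,n-1\}$. A naturally labeled (NL) poset on $X_n$ is a partial order $\preceq$ on $X_n$ with $x\preceq y\Rightarrow x\le y$. A topology of size $n$ is a set $T$ of subsets of $X_n$ containing $\emptyset$ and $X_n$ and closed under union and intersection; it is a naturally labeled topology (NLT) if it equals the set of order ideals (downward closed subsets) of some NL poset on $X_n$. Subsets of $X_n$ are identified with the increasing words of their elements, and the length-lexicographic order compares words first by length, then lexicographically. Definitions: for an NLT $T$ of size $n$ and $S\in T$, $\mathrm{Grow}_S(T)=T\cup\{U\cup\{n\}: U\in T,\ S\subseteq U\}$ (an NLT of size $n+1$). $\mathrm{First}(n)=\mathrm{Grow}_\emptyset^n(\{\emptyset\})$ ($n$-fold application starting from the size-$0$ topology $\{\emptyset\}$). For $T$ of size $n\ge1$, $\mathrm{Cut}(T)=\{U\in T: n-1\notin U\}$ (size $n-1$). For $S\in T$, $\mathrm{Next}_S(T)$ is the element of $T$ immediately following $S$ in the length-lexicographic order, undefined if $S$ is the last element of $T$. $\mathrm{Next}(\{\emptyset\})$ is undefined; for an NLT $T$ of size $n\ge1$, $\mathrm{Next}(T)$ is defined recursively: let $S$ be the smallest (for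 inclusion) set of $T$ containing $n-1$, $S'=S\setminus\{n-1\}$, $T'=\mathrm{Cut}(T)$; if $\mathrm{Next}_{S'}(T')$ is defined, $\mathrm{Next}(T)=\mathrm{Grow}_{S''}(T')$ with $S''=\mathrm{Next}_{S'}(T')$; otherwise, if $\mathrm{Next}(T')$ is defined, $\mathrm{Next}(T)=\mathrm{Grow}_\emptyset(\mathrm{Next}(T'))$; otherwise $\mathrm{Next}(T)$ is undefined. -}

module Defs where

open import Level using (0ℓ)
open import Data.Bool.Properties using () renaming (_≟_ to _≟ᵇ_)
open import Data.Fin using (Fin; fromℕ)
import Data.Fin as Fin
import Data.Fin.Properties as Fin
open import Data.Fin.Subset using (Subset; inside; outside; ⊥; ⊤; _∈_; _∪_; _∩_)
open import Data.Fin.Subset.Properties using (_∈?_; _⊆?_)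
open import Data.List using (List; _++_; [_]; map; filter; find; length; allFin)
open import Data.List.Membership.Propositional using () renaming (_∈_ to _∈ᶠ_)
open import Data.List.Relation.Binary.Lex.Strict using (Lex-<; <-decidable)
open import Data.List.Relation.Unary.All using (all?)
open import Data.Maybe using (Maybe; just; nothing; maybe′; _>>=_)
import Data.Maybe as Maybe
open import Data.Nat using (ℕ; zero; suc; _<_; _<?_; _≟_)
open import Data.Product using (_×_; ∃)
open import Data.Sum using (_⊎_)
open import Data.Vec using (_∷ʳ_; init)
open import Data.Vec.Properties using (≡-dec)
open import Function.Bundles using (_⇔_)
open import Relation.Binary using (Rel; IsDecPartialOrder; Decidable)
open import Relation.Binary.PropositionalEquality using (_≡_)
open import Relation.Nullary.Decidable using (¬?; _×-dec_; _⊎-dec_)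

-- A finite set of subsets of X_n, represented by a list of its elements.
-- Order and multiplicity carry no meaning: two families are the same set
-- when they are related by _∼[ set ]_.
Family : ℕ → Set
Family n = List (Subset n)

record IsTopology {n : ℕ} (T : Family n) : Set where
  field
    ∅∈       : ⊥ ∈ᶠ T
    X∈       : ⊤ ∈ᶠ T
    ∪-closed : ∀ {U V} → U ∈ᶠ T → V ∈ᶠ T → (U ∪ V) ∈ᶠ T
    ∩-closed : ∀ {U V} → U ∈ᶠ T → V ∈ᶠ T → (U ∩ V) ∈ᶠ T

-- Decidability of the order is automatic classically, X_n being finite.
record NLPoset (n : ℕ) : Set₁ where
  field
    _≼_               : Rel (Fin n) 0ℓ
    isDecPartialOrder : IsDecPartialOrder _≡_ _≼_
    natural           : ∀ {x y} → x ≼ y → x Fin.≤ y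

IsOrderIdeal : ∀ {n} → NLPoset n → Subset n → Set
IsOrderIdeal P U = ∀ {x y} → x ≼ y → y ∈ U → x ∈ U
  where open NLPoset P

IsNLT : ∀ {n} → Family n → Set₁
IsNLT {n} T = IsTopology T × ∃ λ (P : NLPoset n) → ∀ U → (U ∈ᶠ T) ⇔ IsOrderIdeal P U

word : ∀ {n} → Subset n → List (Fin n)
word {n} U = filter (_∈? U) (allFin n)

infix 4 _<ₗₗ_ _<ₗₗ?_ _≤ₗₗ_ _≤ₗₗ?_

_<ₗₗ_ : ∀ {n} → Rel (Subset n) 0ℓ
U <ₗₗ V = length (word U) < length (word V)
        ⊎ (length (word U) ≡ length (word V) × Lex-< _≡_ Fin._<_ (word U) (word V))

_<ₗₗ?_ : ∀ {n} → Decidable (_<ₗₗ_ {n})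
U <ₗₗ? V = (length (word U) <? length (word V))
     ⊎-dec ((length (word U) ≟ length (word V))
            ×-dec <-decidable Fin._≟_ Fin._<?_ (word U) (word V))

_≤ₗₗ_ : ∀ {n} → Rel (Subset n) 0ℓ
U ≤ₗₗ V = U ≡ V ⊎ U <ₗₗ V

_≤ₗₗ?_ : ∀ {n} → Decidable (_≤ₗₗ_ {n})
U ≤ₗₗ? V = ≡-dec _≟ᵇ_ U V ⊎-dec (U <ₗₗ? V)

-- An element of the list that is related to all elements of the list.
least : ∀ {A : Set} {_≤_ : Rel A 0ℓ} → Decidable _≤_ → List A → Maybe A
least _≤?_ xs = find (λ x → all? (x ≤?_) xs) xs

-- For U ⊆ X_n, the subsets U and U ∪ {n} of X_{n+1} are U ∷ʳ outside and
-- U ∷ʳ inside; the element n of X_{n+1} is fromℕ n.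
Grow : ∀ {n} → Subset n → Family n → Family (suc n)
Grow S T = map (_∷ʳ outside) T ++ map (_∷ʳ inside) (filter (S ⊆?_) T)

First : ∀ n → Family n
First zero    = [ ⊥ ]
First (suc n) = Grow ⊥ (First n)

Cut : ∀ {n} → Family (suc n) → Family n
Cut {n} T = map init (filter (λ U → ¬? (fromℕ n ∈? U)) T)

NextSet : ∀ {n} → Subset n → Family n → Maybe (Subset n)
NextSet S T = least _≤ₗₗ?_ (filter (S <ₗₗ?_) T)

-- The smallest member of T containing n; it exists whenever T is an NLT.
MinTop : ∀ {n} → Family (suc n) → Maybe (Subset (suc n))
MinTop {n} T = least _⊆?_ (filter (fromℕ n ∈?_) T)

Next : ∀ {n} → Family n → Maybe (Family n)
Next {zero}  T = nothing
Next {suc n} T = MinTop T >>= λ S →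
  maybe′ (λ S″ → just (Grow S″ (Cut T)))
         (Maybe.map (Grow ⊥) (Next (Cut T)))
         (NextSet (init S) (Cut T))

Next^ : ∀ {n} → ℕ → Family n → Maybe (Family n)
Next^ zero    T = just T
Next^ (suc k) T = Next^ k T >>= Next

{-# OPTIONS --safe #-}
-- Up to equality of sets, the topologies of the NL posets on X_{n+1} are the families
-- Grow S T with T the topology of the poset restricted to X_n and S ∈ T the set of
-- elements below the new maximal element n. On such a family Next is explicit: it
-- replaces S by its successor in T and, when S is the last member of T, restarts at ∅
-- over Next T. So the iteration runs through all S ∈ T in length-lexicographic order
-- for each T in the order of the iteration for n, and no pair (T , S) is missed.
-- Since the families reached are literally of the form Grow S T, and Cut (Grow S T) is
-- the list T itself, no invariance of Next under equality of sets is needed.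

module Submission where

open import Defs
open import Data.Nat using (ℕ)
open import Data.Maybe using (just)
open import Data.Product using (∃; _×_)
open import Data.List.Relation.Binary.BagAndSetEquality using (_∼[_]_; set)
open import Function.Bundles using (_⇔_)
open import Relation.Binary.PropositionalEquality using (_≡_)

open import Data.Empty using () renaming (⊥ to Empty)
open import Data.Fin using (Fin; fromℕ; inject₁)
import Data.Fin as Fin
import Data.Fin.Properties as Fin
open import Data.Fin.Relation.Unary.Top using (view; view-fromℕ; view-inject₁; ‵fromℕ; ‵inj₁)
open import Data.Fin.Subset using (Subset; inside; outside; ⊥; _∈_; _⊆_)
open import Data.Fin.Subset.Properties using (_∈?_; _⊆?_; ∉⊥; ∈⊤; ⊆-refl; ⊆-antisym; x∈p∩q⁺; x∈p∩q⁻; x∈p∪q⁺; x∈p∪q⁻)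
open import Data.List using (List; []; _∷_; _++_; map; filter; find; length; allFin)
open import Data.List.Membership.Propositional using () renaming (_∈_ to _∈ᶠ_)
open import Data.List.Membership.Propositional.Properties using (∈-filter⁺; ∈-filter⁻; ∈-map⁺; ∈-map⁻; ∈-++⁺ˡ; ∈-++⁺ʳ; ∈-++⁻; ∈-allFin)
open import Data.List.Properties using (filter-++; filter-all; filter-none; map-∘; map-id-local; ++-identityʳ)
open import Data.List.Relation.Binary.Lex.Strict using (Lex-<; <-isStrictTotalOrder; ¬[]<[])
open import Data.List.Relation.Binary.Pointwise using (Pointwise-≡⇒≡; ≡⇒Pointwise-≡)
open import Data.List.Relation.Unary.All as All using (all?)
open import Data.List.Relation.Unary.All.Properties using (map⁺)
open import Data.List.Relation.Unary.Any using (here; there)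
import Data.List.Extrema as Extrema
open import Data.Maybe using (Maybe; nothing; maybe′; _>>=_)
import Data.Maybe as Maybe
open import Data.Nat using (zero; suc; _<_; _≤_; s≤s; z≤n)
open import Data.Nat.Induction using (<-wellFounded)
import Data.Nat.Properties as ℕ
open import Data.Product using (_,_; proj₁; proj₂)
open import Data.Sum using (_⊎_; inj₁; inj₂; [_,_]′)
open import Data.Unit using (tt) renaming (⊤ to Unit)
open import Data.Vec using ([]; _∷_; _∷ʳ_; init; tabulate; initLast; here; there)
open import Data.Vec.Properties using (init-∷ʳ; ∷ʳ-injective; lookup⇒[]=; []=⇒lookup; lookup∘tabulate)
open import Function using (_∘_; id)
open import Function.Bundles using (mk⇔; Equivalence)
open import Function.Properties.Equivalence using () renaming (sym to ⇔-sym; trans to ⇔-trans)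
open import Induction.WellFounded using (Acc; acc)
open import Level using (0ℓ)
open import Relation.Binary using (Rel; Decidable; Antisymmetric; IsDecPartialOrder; IsStrictTotalOrder; Transitive; IsTotalOrder; TotalOrder; tri<; tri≈; tri>)
open import Relation.Binary.PropositionalEquality using (refl; sym; trans; cong; cong₂; subst; subst₂; isEquivalence; module ≡-Reasoning)
open import Relation.Nullary using (¬_; yes; no; does; contradiction)
open import Relation.Nullary.Decidable using (¬?; dec-true; decidable-stable)
import Relation.Unary as U

open Equivalence using (to; from)

private
  variable
    n : ℕ

-- Least entries of a list and lengths of filtered lists

module _ {A : Set} {_≤′_ : Rel A 0ℓ} (_≤?_ : Decidable _≤′_) where

  private
    find-∈ : ∀ {P : A → Set} (P? : U.Decidable P) xs {y} → find P? xs ≡ just y → y ∈ᶠ xs × P y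
    find-∈ P? (x ∷ xs) eq with P? x
    find-∈ P? (x ∷ xs) refl | yes px = here refl , px
    find-∈ P? (x ∷ xs) eq   | no  _  with find-∈ P? xs eq
    ... | y∈ , py = there y∈ , py

    find-defined : ∀ {P : A → Set} (P? : U.Decidable P) {xs y} → y ∈ᶠ xs → P y → ∃ λ z → find P? xs ≡ just z
    find-defined P? {x ∷ xs} y∈ py with P? x
    find-defined P? {x ∷ xs} y∈          py | yes _  = x , refl
    find-defined P? {x ∷ xs} (here refl) py | no ¬px = contradiction py ¬px
    find-defined P? {x ∷ xs} (there y∈)  py | no _   = find-defined P? y∈ py

  least-∈ : ∀ xs {m} → least _≤?_ xs ≡ just m → m ∈ᶠ xs
  least-∈ xs eq = proj₁ (find-∈ _ xs eq)

  -- The search succeeds because `m` qualifies. It may stop at another entry, but two least entries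
  -- are equal by antisymmetry.
  least-≡ : Antisymmetric _≡_ _≤′_ → ∀ {xs m} → m ∈ᶠ xs → (∀ {y} → y ∈ᶠ xs → m ≤′ y) →
            least _≤?_ xs ≡ just m
  least-≡ antisym {xs} m∈ m≤ with find-defined (λ x → all? (x ≤?_) xs) m∈ (All.tabulate m≤)
  ... | z , eq with find-∈ _ xs eq
  ... | z∈ , z≤ = trans eq (cong just (antisym (All.lookup z≤ m∈) (m≤ z∈)))

module _ {A : Set} {P Q : A → Set} (P? : U.Decidable P) (Q? : U.Decidable Q) (P⇒Q : ∀ {x} → P x → Q x) where

  length-filter-≤ : ∀ xs → length (filter P? xs) ≤ length (filter Q? xs)
  length-filter-≤ []       = z≤n
  length-filter-≤ (x ∷ xs) with P? x | Q? x
  ... | yes _  | yes _  = s≤s (length-filter-≤ xs)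
  ... | yes px | no ¬qx = contradiction (P⇒Q px) ¬qx
  ... | no _   | yes _  = ℕ.m≤n⇒m≤1+n (length-filter-≤ xs)
  ... | no _   | no _   = length-filter-≤ xs

  length-filter-< : ∀ {xs x} → x ∈ᶠ xs → Q x → ¬ P x → length (filter P? xs) < length (filter Q? xs)
  length-filter-< {y ∷ xs} x∈ qx ¬px with P? y | Q? y
  length-filter-< {y ∷ xs} (here refl) qx ¬px | yes py | _      = contradiction py ¬px
  length-filter-< {y ∷ xs} (here refl) qx ¬px | no _   | yes _  = s≤s (length-filter-≤ xs)
  length-filter-< {y ∷ xs} (here refl) qx ¬px | no _   | no ¬qx = contradiction qx ¬qx
  length-filter-< {y ∷ xs} (there x∈)  qx ¬px | yes _  | yes _  = s≤s (length-filter-< x∈ qx ¬px)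
  length-filter-< {y ∷ xs} (there x∈)  qx ¬px | yes py | no ¬qy = contradiction (P⇒Q py) ¬qy
  length-filter-< {y ∷ xs} (there x∈)  qx ¬px | no _   | yes _  = ℕ.m≤n⇒m≤1+n (length-filter-< x∈ qx ¬px)
  length-filter-< {y ∷ xs} (there x∈)  qx ¬px | no _   | no _   = length-filter-< x∈ qx ¬px

-- Successors in a list under a decidable total order

module Successor {A : Set} {_<′_ _≤′_ : Rel A 0ℓ} (_<?_ : Decidable _<′_) (_≤?_ : Decidable _≤′_)
  (isTotalOrder : IsTotalOrder _≡_ _≤′_) (<⇒≱ : ∀ {x y} → x <′ y → ¬ (y ≤′ x))
  (≰⇒> : ∀ {x y} → ¬ (x ≤′ y) → y <′ x) where

  private
    module O = IsTotalOrder isTotalOrder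

    totalOrder : TotalOrder 0ℓ 0ℓ 0ℓ
    totalOrder = record { isTotalOrder = isTotalOrder }

  open Extrema totalOrder using (max; xs≤max; argmax-sel)

  succ : A → List A → Maybe A
  succ x xs = least _≤?_ (filter (x <?_) xs)

  succ-∈ : ∀ x {y} xs → succ x xs ≡ just y → y ∈ᶠ xs
  succ-∈ x xs eq = proj₁ (∈-filter⁻ (x <?_) {xs = xs} (least-∈ _≤?_ _ eq))

  private
    max-∈ : ∀ {b xs} → b ∈ᶠ xs → max b xs ∈ᶠ xs
    max-∈ {b} {xs} b∈ with argmax-sel id b xs
    ... | inj₁ eq = subst (_∈ᶠ xs) (sym eq) b∈
    ... | inj₂ m∈ = m∈

    <⇒≤ : ∀ {x y} → x <′ y → x ≤′ y
    <⇒≤ {x} {y} x<y = [ id , (λ y≤x → contradiction y≤x (<⇒≱ x<y)) ]′ (O.total x y)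

    <-trans : ∀ {x y z} → x <′ y → y <′ z → x <′ z
    <-trans x<y y<z = ≰⇒> λ z≤x → <⇒≱ y<z (O.trans z≤x (<⇒≤ x<y))

  -- The witness is the maximum, above which the filtered list is empty. The entry `b` serves as the
  -- default value of `max`, so the maximum is an entry of the list.
  succ-nothing : ∀ {b xs} → b ∈ᶠ xs → ∃ λ x → x ∈ᶠ xs × succ x xs ≡ nothing
  succ-nothing {b} {xs} b∈ = max b xs , max-∈ b∈ ,
    cong (least _≤?_) (filter-none (max b xs <?_) (All.tabulate λ y∈ m<y → <⇒≱ m<y (All.lookup (xs≤max b xs) y∈)))

  module _ {b : A} (b-minimum : ∀ x → b ≤′ x) {xs : List A} (b∈ : b ∈ᶠ xs) where

    -- The predecessor is the largest entry strictly below `y`. Since `b` is such an entry, the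
    -- maximum with default `b` is one too.
    predecessor : ∀ {y} → y ∈ᶠ xs → b <′ y → ∃ λ x → x ∈ᶠ xs × x <′ y × succ x xs ≡ just y
    predecessor {y} y∈ b<y with ∈-filter⁻ (_<? y) {xs = xs} (max-∈ (∈-filter⁺ (_<? y) b∈ b<y))
    ... | m∈ , m<y = m , m∈ , m<y , least-≡ _≤?_ O.antisym (∈-filter⁺ (m <?_) y∈ m<y) y≤
      where
      m = max b (filter (_<? y) xs)

      y≤ : ∀ {z} → z ∈ᶠ filter (m <?_) xs → y ≤′ z
      y≤ {z} p with ∈-filter⁻ (m <?_) {xs = xs} p | y ≤? z
      -- An entry `z` above `m` but not at or above `y` would be one of the entries below `y`, hence
      -- at most their maximum `m`.
      ... | _        | yes y≤z = y≤z
      ... | z∈ , m<z | no y≰z  =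
        contradiction (All.lookup (xs≤max b _) (∈-filter⁺ (_<? y) z∈ (≰⇒> y≰z))) (<⇒≱ m<z)

    -- Every entry other than `b` is the successor of its predecessor. The descent ends because the
    -- number of entries below, counted with repetitions, drops at each step.
    succ-induction : (P : A → Set) → P b → (∀ {x y} → x ∈ᶠ xs → succ x xs ≡ just y → P x → P y) →
                     ∀ {x} → x ∈ᶠ xs → P x
    succ-induction P Pb step x∈ = go x∈ (<-wellFounded _)
      where
      rank : A → ℕ
      rank x = length (filter (_<? x) xs)

      go : ∀ {x} → x ∈ᶠ xs → Acc _<_ (rank x) → P x
      go {x} x∈ (acc rec) with b <? x
      -- As `b` is a minimum, not lying strictly above it means being equal to it.
      ... | no b≮x = subst P (O.antisym (b-minimum x) (decidable-stable (x ≤? b) (b≮x ∘ ≰⇒>))) Pb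
      ... | yes b<x with predecessor x∈ b<x
      ...   | w , w∈ , w<x , eq = step w∈ eq
        -- The entry `w` is counted in the rank of `x` but not in its own.
        (go w∈ (rec (length-filter-< (_<? w) (_<? x) (λ v<w → <-trans v<w w<x) w∈ w<x λ w<w → <⇒≱ w<w O.refl)))

-- The length-lexicographic order

-- The entries of `word U` are exactly the elements of `U`. This turns a tie between words into
-- equality of subsets, as totality requires.
word-injective : {U V : Subset n} → word U ≡ word V → U ≡ V
word-injective {n} {U} {V} eq = ⊆-antisym (incl U V eq) (incl V U (sym eq))
  where
  incl : ∀ U V → word U ≡ word V → U ⊆ V
  incl U V eq {x} x∈U =
    proj₂ (∈-filter⁻ (_∈? V) {xs = allFin n} (subst (x ∈ᶠ_) eq (∈-filter⁺ (_∈? U) (∈-allFin x) x∈U)))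

word-⊥ : word (⊥ {n}) ≡ []
word-⊥ {n} = filter-none (_∈? ⊥) (All.tabulate {xs = allFin n} λ _ → ∉⊥)

private
  module Lex {n} = IsStrictTotalOrder (<-isStrictTotalOrder (Fin.<-isStrictTotalOrder {n}))

<ₗₗ-irrefl : {U : Subset n} → ¬ (U <ₗₗ U)
<ₗₗ-irrefl (inj₁ l)       = ℕ.<-irrefl refl l
<ₗₗ-irrefl (inj₂ (_ , l)) = Lex.irrefl (≡⇒Pointwise-≡ refl) l

<ₗₗ-trans : Transitive (_<ₗₗ_ {n})
<ₗₗ-trans (inj₁ l)       (inj₁ m)       = inj₁ (ℕ.<-trans l m)
<ₗₗ-trans (inj₁ l)       (inj₂ (e , _)) = inj₁ (subst (_ <_) e l)
<ₗₗ-trans (inj₂ (e , _)) (inj₁ m)       = inj₁ (subst (_< _) (sym e) m)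
<ₗₗ-trans (inj₂ (e , l)) (inj₂ (f , m)) = inj₂ (trans e f , Lex.trans l m)

-- The strict second alternative lets one case analysis serve both totality and `≰⇒>ₗₗ`.
≤ₗₗ-total : (U V : Subset n) → U ≤ₗₗ V ⊎ V <ₗₗ U
≤ₗₗ-total U V with ℕ.<-cmp (length (word U)) (length (word V))
... | tri< l _ _ = inj₁ (inj₂ (inj₁ l))
... | tri> _ _ l = inj₂ (inj₁ l)
... | tri≈ _ e _ with Lex.compare (word U) (word V)
...   | tri< l _ _ = inj₁ (inj₂ (inj₂ (e , l)))
...   | tri≈ _ p _ = inj₁ (inj₁ (word-injective (Pointwise-≡⇒≡ p)))
...   | tri> _ _ l = inj₂ (inj₂ (sym e , l))

≤ₗₗ-isTotalOrder : IsTotalOrder _≡_ (_≤ₗₗ_ {n})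
≤ₗₗ-isTotalOrder {n} = record
  { isPartialOrder = record
    { isPreorder = record
      { isEquivalence = isEquivalence
      ; reflexive     = inj₁
      ; trans         = λ {U} {V} {W} → ≤-trans {U} {V} {W}
      }
    ; antisym = λ {U} {V} → ≤-antisym {U} {V}
    }
  ; total = λ U V → [ inj₁ , inj₂ ∘ inj₂ ]′ (≤ₗₗ-total U V)
  }
  where
  ≤-trans : Transitive (_≤ₗₗ_ {n})
  ≤-trans (inj₁ refl) m           = m
  ≤-trans l           (inj₁ refl) = l
  ≤-trans (inj₂ l)    (inj₂ m)    = inj₂ (<ₗₗ-trans l m)

  ≤-antisym : Antisymmetric _≡_ (_≤ₗₗ_ {n})
  ≤-antisym (inj₁ e)         _        = e
  ≤-antisym (inj₂ l)         (inj₁ e) = sym e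
  ≤-antisym {U} {V} (inj₂ l) (inj₂ m) = contradiction (<ₗₗ-trans {i = U} {V} {U} l m) (<ₗₗ-irrefl {U = U})

private
  <⇒≱ₗₗ : {U V : Subset n} → U <ₗₗ V → ¬ (V ≤ₗₗ U)
  <⇒≱ₗₗ {U = U}     l (inj₁ refl) = <ₗₗ-irrefl {U = U} l
  <⇒≱ₗₗ {U = U} {V} l (inj₂ m)    = <ₗₗ-irrefl {U = U} (<ₗₗ-trans {i = U} {V} {U} l m)

  ≰⇒>ₗₗ : {U V : Subset n} → ¬ (U ≤ₗₗ V) → V <ₗₗ U
  ≰⇒>ₗₗ {U = U} {V} U≰V = [ (λ U≤V → contradiction U≤V U≰V) , id ]′ (≤ₗₗ-total U V)

  -- `LL.succ S T` unfolds to `NextSet S T`, so the results on `succ` apply to `NextSet` directly.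
  module LL {n} = Successor (_<ₗₗ?_ {n}) _≤ₗₗ?_ ≤ₗₗ-isTotalOrder <⇒≱ₗₗ ≰⇒>ₗₗ

-- The word of `⊥` is empty, and nothing precedes the empty word. Hence a run through the members of
-- a family begins at `⊥`.
⊥-≤ₗₗ : (U : Subset n) → ⊥ ≤ₗₗ U
⊥-≤ₗₗ {n} U with ≤ₗₗ-total ⊥ U
... | inj₁ l              = l
... | inj₂ (inj₁ l)       = contradiction (subst (λ w → length (word U) < length w) (word-⊥ {n}) l) λ ()
... | inj₂ (inj₂ (e , l)) = contradiction (subst (Lex-< _≡_ Fin._<_ (word U)) (word-⊥ {n}) l)
                                          (empty-≮ (word U) (trans e (cong length (word-⊥ {n}))))
  where
  empty-≮ : (w : List (Fin n)) → length w ≡ 0 → ¬ Lex-< _≡_ Fin._<_ w []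
  empty-≮ [] _ = ¬[]<[]

-- Computing Next on Grow S T

∈-∷ʳ⁺ : ∀ {U : Subset n} {b x} → x ∈ U → inject₁ x ∈ U ∷ʳ b
∈-∷ʳ⁺ here      = here
∈-∷ʳ⁺ (there p) = there (∈-∷ʳ⁺ p)

∈-∷ʳ⁻ : ∀ (U : Subset n) {b x} → inject₁ x ∈ U ∷ʳ b → x ∈ U
∈-∷ʳ⁻ (_ ∷ U) {x = Fin.zero}  here      = here
∈-∷ʳ⁻ (_ ∷ U) {x = Fin.suc x} (there p) = there (∈-∷ʳ⁻ U p)

fromℕ∈∷ʳ⁺ : ∀ (U : Subset n) → fromℕ n ∈ U ∷ʳ inside
fromℕ∈∷ʳ⁺ []      = here
fromℕ∈∷ʳ⁺ (_ ∷ U) = there (fromℕ∈∷ʳ⁺ U)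

fromℕ∈∷ʳ⁻ : ∀ (U : Subset n) {b} → fromℕ n ∈ U ∷ʳ b → b ≡ inside
fromℕ∈∷ʳ⁻ []      here      = refl
fromℕ∈∷ʳ⁻ (_ ∷ U) (there p) = fromℕ∈∷ʳ⁻ U p

fromℕ∉∷ʳ : ∀ (U : Subset n) → ¬ (fromℕ n ∈ U ∷ʳ outside)
fromℕ∉∷ʳ U p with fromℕ∈∷ʳ⁻ U p
... | ()

∷ʳ-mono-⊆ : ∀ {U V : Subset n} → U ⊆ V → U ∷ʳ inside ⊆ V ∷ʳ inside
∷ʳ-mono-⊆ {U = U} {V} U⊆V {x} x∈ with view x
... | ‵fromℕ  = fromℕ∈∷ʳ⁺ V
... | ‵inj₁ _ = ∈-∷ʳ⁺ (U⊆V (∈-∷ʳ⁻ U x∈))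

-- Both halves of `Grow` are covered at once, since every subset of the larger set has the form
-- `U ∷ʳ b`. `ideal-∷ʳ` has the same shape on the side of posets.
∈-Grow : ∀ (S : Subset n) T {U b} → U ∷ʳ b ∈ᶠ Grow S T ⇔ (U ∈ᶠ T × (b ≡ inside → S ⊆ U))
∈-Grow S T {U} = mk⇔ to′ (λ (U∈ , S⊆) → from′ _ U∈ S⊆)
  where
  to′ : ∀ {b} → U ∷ʳ b ∈ᶠ Grow S T → U ∈ᶠ T × (b ≡ inside → S ⊆ U)
  to′ p with ∈-++⁻ (map (_∷ʳ outside) T) p
  ... | inj₁ q with ∈-map⁻ (_∷ʳ outside) q
  ...   | V , V∈ , eq with ∷ʳ-injective U V eq
  ...     | refl , refl = V∈ , λ ()
  to′ p | inj₂ q with ∈-map⁻ (_∷ʳ inside) q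
  ...   | V , V∈ , eq with ∷ʳ-injective U V eq
  ...     | refl , refl with ∈-filter⁻ (S ⊆?_) {xs = T} V∈
  ...       | V∈T , S⊆V = V∈T , λ _ → S⊆V

  from′ : ∀ b → U ∈ᶠ T → (b ≡ inside → S ⊆ U) → U ∷ʳ b ∈ᶠ Grow S T
  from′ outside U∈ _  = ∈-++⁺ˡ (∈-map⁺ (_∷ʳ outside) U∈)
  from′ inside  U∈ S⊆ = ∈-++⁺ʳ (map (_∷ʳ outside) T) (∈-map⁺ (_∷ʳ inside) (∈-filter⁺ (S ⊆?_) U∈ (S⊆ refl)))

Cut-Grow : ∀ (S : Subset n) T → Cut (Grow S T) ≡ T
Cut-Grow {n} S T = begin
  map init (filter top∉? (outs ++ ins))                ≡⟨ cong (map init) (filter-++ top∉? outs ins) ⟩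
  map init (filter top∉? outs ++ filter top∉? ins)     ≡⟨ cong (map init) (cong₂ _++_ keep drop) ⟩
  map init (outs ++ [])                                ≡⟨ cong (map init) (++-identityʳ outs) ⟩
  map init outs                                        ≡⟨ map-∘ T ⟨
  map (λ U → init (U ∷ʳ outside)) T                    ≡⟨ map-id-local (All.tabulate λ {U} _ → init-∷ʳ outside U) ⟩
  T                                                    ∎
  where
  open ≡-Reasoning
  top∉? = λ (U : Subset (suc n)) → ¬? (fromℕ n ∈? U)
  outs  = map (_∷ʳ outside) T
  ins   = map (_∷ʳ inside) (filter (S ⊆?_) T)

  keep : filter top∉? outs ≡ outs
  keep = filter-all top∉? (map⁺ (All.tabulate λ {U} _ → fromℕ∉∷ʳ U))

  drop : filter top∉? ins ≡ []
  drop = filter-none top∉? (map⁺ {xs = filter (S ⊆?_) T} (All.tabulate λ {U} _ top∉ → top∉ (fromℕ∈∷ʳ⁺ U)))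

-- Members containing the new element arise from some `U` including `S`, and `S` is itself such a
-- `U`. Thus `Next` can recover `S` from the grown family.
MinTop-Grow : ∀ {S : Subset n} {T} → S ∈ᶠ T → MinTop (Grow S T) ≡ just (S ∷ʳ inside)
MinTop-Grow {n} {S} {T} S∈ = least-≡ _⊆?_ ⊆-antisym
  (∈-filter⁺ (fromℕ n ∈?_) (from (∈-Grow S T) (S∈ , λ _ → ⊆-refl)) (fromℕ∈∷ʳ⁺ S)) smallest
  where
  smallest : ∀ {V} → V ∈ᶠ filter (fromℕ n ∈?_) (Grow S T) → S ∷ʳ inside ⊆ V
  smallest {V} p with ∈-filter⁻ (fromℕ n ∈?_) {xs = Grow S T} p
  ... | V∈ , top∈ with initLast V
  ...   | U , b , refl with fromℕ∈∷ʳ⁻ U top∈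
  ...     | refl = ∷ʳ-mono-⊆ (proj₂ (to (∈-Grow S T) V∈) refl)

Next-Grow : ∀ {S : Subset n} {T} → S ∈ᶠ T →
            Next (Grow S T) ≡ maybe′ (λ S″ → just (Grow S″ T)) (Maybe.map (Grow ⊥) (Next T)) (NextSet S T)
Next-Grow {S = S} {T} S∈ rewrite MinTop-Grow S∈ | Cut-Grow S T | init-∷ʳ inside S = refl

Next-Grow-just : ∀ {S S″ : Subset n} {T} → S ∈ᶠ T → NextSet S T ≡ just S″ → Next (Grow S T) ≡ just (Grow S″ T)
Next-Grow-just {T = T} S∈ eq =
  trans (Next-Grow S∈) (cong (maybe′ (λ S″ → just (Grow S″ T)) (Maybe.map (Grow ⊥) (Next T))) eq)

Next-Grow-nothing : ∀ {S : Subset n} {T} → S ∈ᶠ T → NextSet S T ≡ nothing →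
                    Next (Grow S T) ≡ Maybe.map (Grow ⊥) (Next T)
Next-Grow-nothing {T = T} S∈ eq =
  trans (Next-Grow S∈) (cong (maybe′ (λ S″ → just (Grow S″ T)) (Maybe.map (Grow ⊥) (Next T))) eq)

-- Families obtained by repeated growth

-- The index keeps the literal form `Grow S T`, so matching on a derivation supplies the `S` and `T`
-- to which `Next-Grow` applies.
data Built : Family n → Set where
  base : Built {zero} (First zero)
  grow : ∀ {T : Family n} {S} → Built T → S ∈ᶠ T → Built (Grow S T)

∷ʳ-⊥ : ∀ n → ⊥ {n} ∷ʳ outside ≡ ⊥
∷ʳ-⊥ zero    = refl
∷ʳ-⊥ (suc n) = cong (outside ∷_) (∷ʳ-⊥ n)

Built-⊥∈ : {T : Family n} → Built T → ⊥ ∈ᶠ T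
Built-⊥∈ base                   = here refl
Built-⊥∈ (grow {n} {T} {S} B _) =
  subst (_∈ᶠ Grow S T) (∷ʳ-⊥ n) (from (∈-Grow S T) (Built-⊥∈ B , λ ()))

Built-First : ∀ n → Built (First n)
Built-First zero    = base
Built-First (suc n) = grow (Built-First n) (Built-⊥∈ (Built-First n))

-- Either outcome of `Next` is again a growth at a member: a successor is taken from `T`, and `⊥`
-- belongs to `Next T`, which is built by recursion.
Built-Next : {T T′ : Family n} → Built T → Next T ≡ just T′ → Built T′
Built-Next (grow {T = T} {S} B S∈) eq with NextSet S T in nextSet | trans (sym (Next-Grow S∈)) eq
... | just S″ | refl = grow B (LL.succ-∈ S T nextSet)
... | nothing | eq′ with Next T in next | eq′
...   | just T″ | refl = grow (Built-Next B next) (Built-⊥∈ (Built-Next B next))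

Built-Next^ : ∀ k {T T′ : Family n} → Built T → Next^ k T ≡ just T′ → Built T′
Built-Next^ zero    B refl = B
Built-Next^ (suc k) {T} B eq with Next^ k T in eqₖ
... | just T₁ = Built-Next (Built-Next^ k B eqₖ) eq

-- Families reached by iterating `Next`

data Reached (T : Family n) : Set where
  after : ∀ k → Next^ k (First n) ≡ just T → Reached T

Reached-Next : {T T′ : Family n} → Reached T → Next T ≡ just T′ → Reached T′
Reached-Next (after k eq) next = after (suc k) (trans (cong (_>>= Next) eq) next)

Reached-Grow : {T : Family n} → ⊥ ∈ᶠ T → Reached (Grow ⊥ T) → ∀ {S} → S ∈ᶠ T → Reached (Grow S T)
Reached-Grow {T = T} ⊥∈ reached = LL.succ-induction ⊥-≤ₗₗ ⊥∈ (λ S → Reached (Grow S T)) reached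
  λ {S} {S″} S∈ eq rS → Reached-Next {T = Grow S T} rS (Next-Grow-just {S = S} {S″} {T} S∈ eq)

-- The iteration first runs over `T` up to its last member `L`. There `NextSet` is undefined, and
-- the next step moves on to `T′`.
Reached-Grow-Next : {T T′ : Family n} → ⊥ ∈ᶠ T → Reached (Grow ⊥ T) → Next T ≡ just T′ → Reached (Grow ⊥ T′)
Reached-Grow-Next {T = T} {T′} ⊥∈ reached next = fromLast (LL.succ-nothing ⊥∈)
  where
  fromLast : (∃ λ L → L ∈ᶠ T × NextSet L T ≡ nothing) → Reached (Grow ⊥ T′)
  fromLast (L , L∈ , last) = Reached-Next (Reached-Grow ⊥∈ reached L∈)
    (trans (Next-Grow-nothing {S = L} L∈ last) (cong (Maybe.map (Grow ⊥)) next))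

-- Induction on the steps taken at size `n`: each of them becomes a full run at size `suc n`. The
-- start is immediate, `First (suc n)` being `Grow ⊥ (First n)` by definition.
Reached-Grow-⊥ : ∀ k {T : Family n} → Next^ k (First n) ≡ just T → Reached (Grow ⊥ T)
Reached-Grow-⊥ zero refl = after 0 refl
Reached-Grow-⊥ {n} (suc k) eq with Next^ k (First n) in eqₖ
... | just T₀ = Reached-Grow-Next (Built-⊥∈ (Built-Next^ k (Built-First n) eqₖ)) (Reached-Grow-⊥ k eqₖ) eq

Built-Reached : {T : Family n} → Built T → Reached T
Built-Reached base        = after 0 refl
Built-Reached (grow B S∈) with Built-Reached B
... | after k eq = Reached-Grow (Built-⊥∈ B) (Reached-Grow-⊥ k eq) S∈

-- Growth and posets

Represents : Family n → NLPoset n → Set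
Represents T P = ∀ U → U ∈ᶠ T ⇔ IsOrderIdeal P U

Represents⇒IsTopology : {T : Family n} (P : NLPoset n) → Represents T P → IsTopology T
Represents⇒IsTopology P rep = record
  { ∅∈       = from (rep _) λ _ y∈ → contradiction y∈ ∉⊥
  ; X∈       = from (rep _) λ _ _ → ∈⊤
  ; ∪-closed = λ {U} {V} U∈ V∈ → from (rep _) λ x≼y y∈ →
      [ x∈p∪q⁺ {p = U} {V} ∘ inj₁ ∘ to (rep U) U∈ x≼y , x∈p∪q⁺ {p = U} {V} ∘ inj₂ ∘ to (rep V) V∈ x≼y ]′ (x∈p∪q⁻ U V y∈)
  ; ∩-closed = λ {U} {V} U∈ V∈ → from (rep _) λ x≼y y∈ →
      let y∈U , y∈V = x∈p∩q⁻ U V y∈ in x∈p∩q⁺ (to (rep U) U∈ x≼y y∈U , to (rep V) V∈ x≼y y∈V)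
  }

-- Stated as a relation so that one proof of `Represents-Grow` serves both `adjoin`, which starts
-- from `P` and `S`, and `restrict`, which starts from `P⁺`.
record Extends (P⁺ : NLPoset (suc n)) (P : NLPoset n) (S : Subset n) : Set where
  open NLPoset P⁺ using () renaming (_≼_ to _≼⁺_)
  open NLPoset P using (_≼_)
  field
    inject₁-≼ : ∀ {x y} → inject₁ x ≼⁺ inject₁ y ⇔ x ≼ y
    ≼-top     : ∀ {x} → inject₁ x ≼⁺ fromℕ n ⇔ x ∈ S

module _ {P⁺ : NLPoset (suc n)} {P : NLPoset n} {S : Subset n} (E : Extends P⁺ P S) where

  open NLPoset P⁺ using (natural; isDecPartialOrder) renaming (_≼_ to _≼⁺_)
  open NLPoset P using (_≼_)
  open Extends E

  -- Transitivity through the new element. In `∃-Built` this makes `belowTop P` a member of the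
  -- family to be grown.
  Extends-ideal : IsOrderIdeal P S
  Extends-ideal x≼y y∈S =
    to ≼-top (IsDecPartialOrder.trans isDecPartialOrder (from inject₁-≼ x≼y) (from ≼-top y∈S))

  private
    top⋠ : ∀ {x} → ¬ (fromℕ n ≼⁺ inject₁ x)
    top⋠ {x} t≼x = ℕ.<⇒≱ (Fin.inject₁ℕ< x) (subst (_≤ Fin.toℕ (inject₁ x)) (Fin.toℕ-fromℕ n) (natural t≼x))

  -- By naturality the new element lies below no old one, so it constrains an ideal only when it
  -- belongs to it. The ideal must then contain what lies below it, namely `S`.
  ideal-∷ʳ : ∀ {U b} → (IsOrderIdeal P U × (b ≡ inside → S ⊆ U)) ⇔ IsOrderIdeal P⁺ (U ∷ʳ b)
  ideal-∷ʳ {U} {b} = mk⇔ to′ from′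
    where
    to′ : IsOrderIdeal P U × (b ≡ inside → S ⊆ U) → IsOrderIdeal P⁺ (U ∷ʳ b)
    to′ (I , S⊆) {x} {y} x≼y y∈ with view x | view y
    ... | ‵fromℕ  | ‵fromℕ  = y∈
    ... | ‵fromℕ  | ‵inj₁ _ = contradiction x≼y top⋠
    ... | ‵inj₁ _ | ‵fromℕ  = ∈-∷ʳ⁺ (S⊆ (fromℕ∈∷ʳ⁻ U y∈) (to ≼-top x≼y))
    ... | ‵inj₁ _ | ‵inj₁ _ = ∈-∷ʳ⁺ (I (to inject₁-≼ x≼y) (∈-∷ʳ⁻ U y∈))

    from′ : IsOrderIdeal P⁺ (U ∷ʳ b) → IsOrderIdeal P U × (b ≡ inside → S ⊆ U)
    from′ I = (λ x≼y y∈U → ∈-∷ʳ⁻ U (I (from inject₁-≼ x≼y) (∈-∷ʳ⁺ y∈U)))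
            , λ { refl x∈S → ∈-∷ʳ⁻ U (I (from ≼-top x∈S) (fromℕ∈∷ʳ⁺ U)) }

  Represents-Grow : ∀ {T} → Represents T P → Represents (Grow S T) P⁺
  Represents-Grow {T} rep V with initLast V
  ... | U , b , refl = ⇔-trans (∈-Grow S T) (⇔-trans (mk⇔ to′ from′) ideal-∷ʳ)
    where
    to′ : U ∈ᶠ T × (b ≡ inside → S ⊆ U) → IsOrderIdeal P U × (b ≡ inside → S ⊆ U)
    to′ (U∈ , S⊆) = to (rep U) U∈ , S⊆

    from′ : IsOrderIdeal P U × (b ≡ inside → S ⊆ U) → U ∈ᶠ T × (b ≡ inside → S ⊆ U)
    from′ (I , S⊆) = from (rep U) I , S⊆

-- Adjoining a maximal element to a poset

lower : Fin (suc n) → Maybe (Fin n)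
lower i with view i
... | ‵fromℕ          = nothing
... | ‵inj₁ {i = j} _ = just j

lower-fromℕ : ∀ n → lower (fromℕ n) ≡ nothing
lower-fromℕ n rewrite view-fromℕ n = refl

lower-inject₁ : (i : Fin n) → lower (inject₁ i) ≡ just i
lower-inject₁ i rewrite view-inject₁ i = refl

module _ (P : NLPoset n) (S : Subset n) (S-ideal : IsOrderIdeal P S) where

  open NLPoset P
  private module P = IsDecPartialOrder isDecPartialOrder

  private
    -- Through lower, nothing stands for the new element n, placed above exactly S.
    _⊑_ : Rel (Maybe (Fin n)) 0ℓ
    just x  ⊑ just y  = x ≼ y
    just x  ⊑ nothing = x ∈ S
    nothing ⊑ just _  = Empty
    nothing ⊑ nothing = Unit

    ⊑-refl : ∀ a → a ⊑ a
    ⊑-refl (just _) = P.refl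
    ⊑-refl nothing  = tt

    ⊑-trans : ∀ a b c → a ⊑ b → b ⊑ c → a ⊑ c
    ⊑-trans (just _) (just _) (just _) p q = P.trans p q
    -- The case for which `S` has to be an ideal.
    ⊑-trans (just _) (just _) nothing  p q = S-ideal p q
    ⊑-trans (just _) nothing  nothing  p _ = p
    ⊑-trans nothing  nothing  nothing  _ _ = tt

    _⊑?_ : Decidable _⊑_
    just x  ⊑? just y  = x P.≤? y
    just x  ⊑? nothing = x ∈? S
    nothing ⊑? just _  = no λ ()
    nothing ⊑? nothing = yes tt

    lower-natural : ∀ {x y} → lower x ⊑ lower y → x Fin.≤ y
    lower-natural {x} {y} p with view x | view y
    ... | ‵fromℕ          | ‵fromℕ          = ℕ.≤-refl
    ... | ‵inj₁ {i = i} _ | ‵fromℕ          = Fin.≤fromℕ (inject₁ i)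
    ... | ‵inj₁ {i = i} _ | ‵inj₁ {i = j} _ =
      subst₂ _≤_ (sym (Fin.toℕ-inject₁ i)) (sym (Fin.toℕ-inject₁ j)) (natural p)

  adjoin : NLPoset (suc n)
  adjoin = record
    { _≼_ = λ x y → lower x ⊑ lower y
    ; isDecPartialOrder = record
      { isPartialOrder = record
        { isPreorder = record
          { isEquivalence = isEquivalence
          ; reflexive     = λ { {x} refl → ⊑-refl (lower x) }
          ; trans         = λ {x} {y} {z} → ⊑-trans (lower x) (lower y) (lower z)
          }
        -- Antisymmetry is inherited from the order of the labels, through naturality in both
        -- directions.
        ; antisym = λ {x} {y} p q → Fin.≤-antisym (lower-natural {x} {y} p) (lower-natural {y} {x} q)
        }
      ; _≟_  = Fin._≟_
      ; _≤?_ = λ x y → lower x ⊑? lower y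
      }
    ; natural = λ {x} {y} → lower-natural {x} {y}
    }

  adjoin-Extends : Extends adjoin P S
  adjoin-Extends = record { inject₁-≼ = inj ; ≼-top = top }
    where
    inj : ∀ {x y} → lower (inject₁ x) ⊑ lower (inject₁ y) ⇔ x ≼ y
    inj {x} {y} rewrite lower-inject₁ x | lower-inject₁ y = mk⇔ id id

    top : ∀ {x} → lower (inject₁ x) ⊑ lower (fromℕ n) ⇔ x ∈ S
    top {x} rewrite lower-inject₁ x | lower-fromℕ n = mk⇔ id id

-- Removing the largest label from a poset

module _ (P⁺ : NLPoset (suc n)) where

  open NLPoset P⁺
  private module P⁺ = IsDecPartialOrder isDecPartialOrder

  restrict : NLPoset n
  restrict = record
    { _≼_ = λ x y → inject₁ x ≼ inject₁ y
    ; isDecPartialOrder = record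
      { isPartialOrder = record
        { isPreorder = record
          { isEquivalence = isEquivalence
          ; reflexive     = λ { refl → P⁺.refl }
          ; trans         = P⁺.trans
          }
        ; antisym = λ p q → Fin.inject₁-injective (P⁺.antisym p q)
        }
      ; _≟_  = Fin._≟_
      ; _≤?_ = λ x y → inject₁ x P⁺.≤? inject₁ y
      }
    ; natural = λ {x} {y} p → subst₂ _≤_ (Fin.toℕ-inject₁ x) (Fin.toℕ-inject₁ y) (natural p)
    }

  belowTop : Subset n
  belowTop = tabulate λ x → does (inject₁ x P⁺.≤? fromℕ n)

  restrict-Extends : Extends P⁺ restrict belowTop
  restrict-Extends = record { inject₁-≼ = mk⇔ id id ; ≼-top = mk⇔ to′ from′ }
    where
    to′ : ∀ {x} → inject₁ x ≼ fromℕ n → x ∈ belowTop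
    to′ {x} p = lookup⇒[]= x belowTop (trans (lookup∘tabulate _ x) (dec-true (_ P⁺.≤? _) p))

    from′ : ∀ {x} → x ∈ belowTop → inject₁ x ≼ fromℕ n
    from′ {x} x∈ with inject₁ x P⁺.≤? fromℕ n | trans (sym (lookup∘tabulate (λ x → does (inject₁ x P⁺.≤? fromℕ n)) x)) ([]=⇒lookup x∈)
    -- A negative decision would make the accompanying equation read `outside ≡ inside`.
    ... | yes p | _ = p

-- Built families as the families of order ideals

Represents-base : (P : NLPoset zero) → Represents (First zero) P
Represents-base P [] = mk⇔ (λ { _ {()} }) (λ _ → here refl)

emptyPoset : NLPoset zero
emptyPoset = record
  { _≼_ = _≡_
  ; isDecPartialOrder = record
    { isPartialOrder = record
      { isPreorder = record { isEquivalence = isEquivalence ; reflexive = id ; trans = trans }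
      ; antisym    = λ p _ → p
      }
    ; _≟_  = Fin._≟_
    ; _≤?_ = Fin._≟_
    }
  ; natural = λ { refl → ℕ.≤-refl }
  }

-- By induction the members of the smaller family are ideals of its poset, so the growing set `S` is
-- an ideal above which a new element can be placed.
Built⇒Represents : {T : Family n} → Built T → ∃ (Represents T)
Built⇒Represents base = emptyPoset , Represents-base emptyPoset
Built⇒Represents (grow {S = S} B S∈) with Built⇒Represents B
... | P , rep = adjoin P S S-ideal , Represents-Grow (adjoin-Extends P S S-ideal) rep
  where
  S-ideal : IsOrderIdeal P S
  S-ideal = to (rep S) S∈

∃-Built : (P : NLPoset n) → ∃ λ T → Built T × Represents T P
∃-Built {zero}  P = First zero , base , Represents-base P
∃-Built {suc n} P with ∃-Built (restrict P)
... | T , B , rep = Grow (belowTop P) T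
                  , grow B (from (rep _) (Extends-ideal (restrict-Extends P)))
                  , Represents-Grow (restrict-Extends P) rep

theorem5p11 : (n : ℕ) (T : Family n) →
    (∃ λ k → ∃ λ T′ → (Next^ k (First n) ≡ just T′) × (T′ ∼[ set ] T)) ⇔ IsNLT T
theorem5p11 n T = mk⇔ sound complete
  where
  sound : (∃ λ k → ∃ λ T′ → (Next^ k (First n) ≡ just T′) × (T′ ∼[ set ] T)) → IsNLT T
  sound (k , T′ , eq , T′∼T) with Built⇒Represents (Built-Next^ k (Built-First n) eq)
  ... | P , rep = Represents⇒IsTopology P rep′ , P , rep′
    where
    rep′ : Represents T P
    rep′ U = ⇔-trans (⇔-sym T′∼T) (rep U)

  complete : IsNLT T → ∃ λ k → ∃ λ T′ → (Next^ k (First n) ≡ just T′) × (T′ ∼[ set ] T)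
  complete (_ , P , rep) with ∃-Built P
  ... | T′ , B , rep′ with Built-Reached B
  -- Both families consist of the ideals of the same `P`, hence agree as sets.
  ...   | after k eq = k , T′ , eq , λ {U} → ⇔-trans (rep′ U) (⇔-sym (rep U))
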